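{- Let $P$ be a finite poset and let $t\geq 2$ be a fixed integer. Then, as $n\to\infty$, either $\mathrm{sat}^{\star}([t]^n,P)=\Omega(\sqrt{n})$ or $\mathrm{sat}^{\star}([t]^n,P)=O(1)$.
   Context: For positive integers $n,t$, $[n]=\{1,\dots,n\}$ and the hypergrid $[t]^n$ is the set of functions $f:[n]\to[t]$, partially ordered by $f\leq g$ iff $f(i)\leq g(i)$ for all $i\in[n]$. An induced copy of a poset $P$ in a family $\mathcal{F}\subseteq[t]^n$ is an injective map $\phi:P\to\mathcal{F}$ such that $\phi(x)\leq\phi(y)$ iff $x\leq_P y$. A family $\mathcal{F}\subseteq[t]^n$ is induced $P$-free if it contains no induced copy of $P$; it is induced $P$-saturated if it is induced $P$-free and for every $f\in[t]^n\setminus\mathcal{F}$ the family $\mathcal{F}\cup\{f\}$ contains an induced copy of $P$. Whenever $P$ embeds as an induced subposet of $[t]^n$, $\mathrm{sat}^{\star}([t]^n,P)$ denotes the minimum size of an induced $P$-saturated family in $[t]^n$. Asymptotic notation is as $n\to\infty$ with $t$ and $P$ fixed. -}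

module Defs where

open import Axiom.ExcludedMiddle using (ExcludedMiddle)
open import Data.Fin as Fin using (Fin)
open import Data.List using (List; _∷_; length)
open import Data.List.Membership.Propositional using (_∈_; _∉_)
open import Data.List.Relation.Unary.Unique.Propositional using (Unique)
open import Data.Nat using (ℕ; _*_; _≤_; _<_)
open import Data.Product using (∃; ∃-syntax; _×_; _,_)
open import Data.Vec using (Vec; lookup)
open import Function.Bundles using (_↔_; _⇔_)
open import Function.Definitions using (Injective)
open import Level using (0ℓ)
open import Relation.Binary using (Rel; IsPartialOrder)
open import Relation.Binary.PropositionalEquality using (_≡_)
open import Relation.Nullary using (¬_; Dec; yes; no)

record FinitePoset : Set₁ where
  infix 4 _⊑_
  field
    Carrier        : Set
    _⊑_            : Rel Carrier 0ℓ
    isPartialOrder : IsPartialOrder _≡_ _⊑_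
    size           : ℕ
    finite         : Carrier ↔ Fin size

-- A function [n] → [t] is stored as its vector of values, so that
-- propositional equality is equality of functions; [t] is {0, …, t − 1}.
Grid : ℕ → ℕ → Set
Grid t n = Vec (Fin t) n

infix 4 _≤ᴳ_
_≤ᴳ_ : ∀ {t n} → Rel (Grid t n) 0ℓ
f ≤ᴳ g = ∀ i → lookup f i Fin.≤ lookup g i

-- A family is the set of entries of a list.  Its cardinality is the length
-- of the list only when the list is Unique, which IsSat demands.
Family : ℕ → ℕ → Set
Family t n = List (Grid t n)

module _ (P : FinitePoset) where
  open FinitePoset P

  record InducedCopy {t n} (F : Family t n) : Set where
    field
      φ         : Carrier → Grid t n
      in-family : ∀ x → φ x ∈ F
      injective : Injective _≡_ _≡_ φ
      induced   : ∀ x y → (φ x ≤ᴳ φ y) ⇔ (x ⊑ y)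

  InducedFree : ∀ {t n} → Family t n → Set
  InducedFree F = ¬ InducedCopy F

  InducedSaturated : ∀ {t n} → Family t n → Set
  InducedSaturated F = InducedFree F × (∀ f → f ∉ F → InducedCopy (f ∷ F))

  IsSat : ℕ → ℕ → ℕ → Set
  IsSat t n m =
      (∃[ F ] Unique F × InducedSaturated {t} {n} F × length F ≡ m)
    × (∀ (F : Family t n) → Unique F → InducedSaturated F → m ≤ length F)

-- The value 0 in the second case is a convention for a property no number
-- satisfies.
witnessOr0 : {Q : ℕ → Set} → Dec (∃ Q) → ℕ
witnessOr0 (yes (m , _)) = m
witnessOr0 (no _)        = 0

-- sat⋆([t]ⁿ, P).  At most one m satisfies IsSat P t n m; one exists whenever P
-- is nonempty.  (An induced copy of the empty poset lies in every family.)
sat⋆ : ExcludedMiddle 0ℓ → FinitePoset → ℕ → ℕ → ℕ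
sat⋆ em P t n = witnessOr0 (em {∃[ m ] IsSat P t n m})

-- f(n) ≥ (p / q) · √n for all large n, with both sides squared and
-- denominators cleared.
Ω[√n] : (ℕ → ℕ) → Set
Ω[√n] f = ∃[ p ] ∃[ q ] ∃[ N ] 0 < p × 0 < q ×
  (∀ n → N ≤ n → (p * p) * n ≤ (q * q) * (f n * f n))

O[1] : (ℕ → ℕ) → Set
O[1] f = ∃[ C ] ∃[ N ] (∀ n → N ≤ n → f n ≤ C)

{-# OPTIONS --safe #-}
-- Let F be a saturated family in [t]ⁿ with |F|² < n.  Every pair g, h ∈ F is
-- distinguished by at most one coordinate alone (g ≰ h only because of it), so
-- some coordinate i is redundant: the order on F is determined by the other
-- coordinates.  Replace the value at i by 0 or t − 1 according to whether it is
-- zero, and repeat the new coordinate any number of times.  The family obtained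
-- is order isomorphic to F.  A new point f meets it through A = {g : g ≤ f} and
-- B = {h : f ≤ h}; relative to the other coordinates, the repeated coordinate
-- can only remove from A the members that are nonzero at i, or from B those that
-- are zero at i.  By redundancy every member of A is at most every member of B,
-- so at most one of these removals does anything, and a single value at i already
-- produces it in [t]ⁿ.  Hence the new family is saturated, of size |F|, in every
-- larger dimension.  If no such F exists then sat⋆² ≥ n throughout.
module Submission where

open import Axiom.ExcludedMiddle using (ExcludedMiddle)
open import Axiom.DoubleNegationElimination using (em⇒dne)
open import Data.Empty using (⊥; ⊥-elim)
open import Data.Fin as Fin using (Fin; zero; suc; fromℕ; _↑ˡ_; splitAt; combine)
import Data.Fin.Properties as Finₚ
open import Data.List as List using (List; []; _∷_; length; map; filter; allFin; cartesianProductWith)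
import Data.List.Extrema as Extrema
open import Data.List.Membership.Propositional using (_∈_; _∉_)
open import Data.List.Membership.Propositional.Properties using (∈-map⁺; ∈-map⁻; ∈-filter⁺; ∈-filter⁻; ∈-allFin; ∈-cartesianProductWith⁺)
open import Data.List.Properties using (length-map)
open import Data.List.Relation.Binary.Subset.Propositional using (_⊆_)
open import Data.List.Relation.Binary.Subset.Propositional.Properties using (xs⊆x∷xs; ∷⁺ʳ)
import Data.List.Relation.Unary.All as All
import Data.List.Relation.Unary.All.Properties as Allₚ
open import Data.List.Relation.Unary.AllPairs using ([]; _∷_)
open import Data.List.Relation.Unary.Any using (here; there; index)
open import Data.List.Relation.Unary.Any.Properties using (lookup-index)
open import Data.List.Relation.Unary.Unique.Propositional using (Unique)
open import Data.Nat using (ℕ; zero; suc; _+_; _*_; _≤_; _<_; z≤n; s≤s; z<s)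
import Data.Nat.Properties as ℕₚ
open import Data.Nat.Induction using (<-rec)
open import Data.Product using (∃; ∃-syntax; _×_; _,_; proj₁; proj₂)
open import Data.Sum using (_⊎_; inj₁; inj₂; [_,_]′)
open import Data.Vec using ([]; _∷_; lookup; tabulate; updateAt; _[_]≔_)
import Data.Vec.Properties as Vecₚ
import Data.Vec.Relation.Binary.Pointwise.Extensional as Ext
open import Function using (_∘_; const; id; case_of_)
open import Function.Bundles using (_⇔_; mk⇔; Equivalence)
open import Level using (0ℓ)
open import Relation.Binary using (IsPartialOrder)
open import Relation.Binary.PropositionalEquality using (_≡_; _≢_; refl; sym; trans; cong; subst; subst₂)
open import Relation.Nullary using (¬_; Dec; yes; no)
open import Relation.Nullary.Decidable using (decidable-stable)
open import Defs

open Equivalence using (to; from)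

-- Order and enumeration of the grid.

≤ᴳ-refl : ∀ {t n} (f : Grid t n) → f ≤ᴳ f
≤ᴳ-refl f i = Finₚ.≤-refl

≤ᴳ-antisym : ∀ {t n} {f g : Grid t n} → f ≤ᴳ g → g ≤ᴳ f → f ≡ g
≤ᴳ-antisym f≤g g≤f = Ext.Pointwise-≡⇒≡ (Ext.ext λ i → Finₚ.≤-antisym (f≤g i) (g≤f i))

grid : ∀ t n → List (Grid t n)
grid t zero    = [] ∷ []
grid t (suc n) = cartesianProductWith _∷_ (allFin t) (grid t n)

∈-grid : ∀ {t n} (f : Grid t n) → f ∈ grid t n
∈-grid []      = here refl
∈-grid (x ∷ f) = ∈-cartesianProductWith⁺ _∷_ (∈-allFin x) (∈-grid f)

-- Injectivity is asked only between entries of `xs`: the map used later may merge grid points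
-- outside the family.
Unique-map⁺ : ∀ {A B : Set} (e : A → B) {xs : List A} →
  (∀ {x y} → x ∈ xs → y ∈ xs → e x ≡ e y → x ≡ y) → Unique xs → Unique (map e xs)
Unique-map⁺ e inj []         = []
Unique-map⁺ e inj (px ∷ pxs) =
  Allₚ.map⁺ (All.tabulate λ y∈ ex≡ey →
    All.lookup px y∈ (inj (here refl) (there y∈) ex≡ey))
  ∷ Unique-map⁺ e (λ x∈ y∈ → inj (there x∈) (there y∈)) pxs

-- Transferring induced copies and saturation along a map.

module _ (P : FinitePoset) where
  open FinitePoset P
  open IsPartialOrder isPartialOrder using (antisym)

  -- Injectivity comes for free: equal images are comparable both ways, and `antisym` applies.
  inducedCopy : ∀ {t n} {F : Family t n} (φ : Carrier → Grid t n) →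
    (∀ x → φ x ∈ F) → (∀ x y → (φ x ≤ᴳ φ y) ⇔ (x ⊑ y)) → InducedCopy P F
  inducedCopy φ φ∈F ind = record
    { φ = φ
    ; in-family = φ∈F
    ; injective = λ {x} {y} eq → antisym
        (to (ind x y) (subst (φ x ≤ᴳ_) eq (≤ᴳ-refl (φ x))))
        (to (ind y x) (subst (_≤ᴳ φ x) eq (≤ᴳ-refl (φ x))))
    ; induced = ind
    }

  InducedCopy-⊆ : ∀ {t n} {F G : Family t n} → F ⊆ G → InducedCopy P F → InducedCopy P G
  InducedCopy-⊆ F⊆G c = record
    { InducedCopy c
    ; in-family = λ x → F⊆G (InducedCopy.in-family c x)
    }

  -- `e` takes the membership proof, so it can treat the head of a list apart from its tail, or pick
  -- preimages under `map`.
  InducedCopy-transfer : ∀ {t m n} {F : Family t m} {G : Family t n}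
    (e : ∀ {f} → f ∈ F → Grid t n) → (∀ {f} (p : f ∈ F) → e p ∈ G) →
    (∀ {f g} (p : f ∈ F) (q : g ∈ F) → (e p ≤ᴳ e q) ⇔ (f ≤ᴳ g)) →
    InducedCopy P F → InducedCopy P G
  InducedCopy-transfer e e∈G e-⇔ c = inducedCopy
    (λ x → e (in-family x))
    (λ x → e∈G (in-family x))
    (λ x y → mk⇔
      (to (induced x y) ∘ to (e-⇔ (in-family x) (in-family y)))
      (from (e-⇔ (in-family x) (in-family y)) ∘ from (induced x y)))
    where open InducedCopy c

  module _ {t m n : ℕ} (F : Family t n) (e : Grid t n → Grid t m)
    (e-⇔ : ∀ {g h} → g ∈ F → h ∈ F → (e g ≤ᴳ e h) ⇔ (g ≤ᴳ h)) where

    map-Unique : Unique F → Unique (map e F)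
    map-Unique = Unique-map⁺ e λ {x} {y} x∈ y∈ eq → ≤ᴳ-antisym
      (to (e-⇔ x∈ y∈) (subst (e x ≤ᴳ_) eq (≤ᴳ-refl (e x))))
      (to (e-⇔ y∈ x∈) (subst (_≤ᴳ e x) eq (≤ᴳ-refl (e x))))

    map-InducedFree : InducedFree P F → InducedFree P (map e F)
    map-InducedFree free c = free (InducedCopy-transfer pre pre∈ pre-⇔ c)
      where
      pre : ∀ {f} → f ∈ map e F → Grid t n
      pre p = proj₁ (∈-map⁻ e p)

      pre∈ : ∀ {f} (p : f ∈ map e F) → pre p ∈ F
      pre∈ p = proj₁ (proj₂ (∈-map⁻ e p))

      pre-⇔ : ∀ {f g} (p : f ∈ map e F) (q : g ∈ map e F) → (pre p ≤ᴳ pre q) ⇔ (f ≤ᴳ g)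
      pre-⇔ p q with ∈-map⁻ e p | ∈-map⁻ e q
      ... | _ , g∈ , refl | _ , h∈ , refl = mk⇔ (from (e-⇔ g∈ h∈)) (to (e-⇔ g∈ h∈))

    -- The point `f′` meets `F` exactly as `f` meets the image, so a copy created by `f′` turns into
    -- one created by `f`.
    map-InducedSaturated :
      (∀ f → ∃[ f′ ] (∀ {g} → g ∈ F → (f ≤ᴳ e g) ⇔ (f′ ≤ᴳ g))
                   × (∀ {g} → g ∈ F → (e g ≤ᴳ f) ⇔ (g ≤ᴳ f′))) →
      InducedSaturated P F → InducedSaturated P (map e F)
    map-InducedSaturated proxy (free , sat) = map-InducedFree free , sat′
      where
      sat′ : ∀ f → f ∉ map e F → InducedCopy P (f ∷ map e F)
      sat′ f f∉ with proxy f
      ... | f′ , up , down = InducedCopy-transfer ext ext∈ ext-⇔ (sat f′ f′∉)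
        where
        -- If `f′` were in `F`, reflexivity would put `f` and `e f′` each below the other, making
        -- `f` a member of the image.
        f′∉ : f′ ∉ F
        f′∉ f′∈ = f∉ (subst (_∈ map e F)
          (≤ᴳ-antisym (from (down f′∈) (≤ᴳ-refl f′)) (from (up f′∈) (≤ᴳ-refl f′)))
          (∈-map⁺ e f′∈))

        ext : ∀ {g} → g ∈ f′ ∷ F → Grid t m
        ext (here _)      = f
        ext {g} (there _) = e g

        ext∈ : ∀ {g} (p : g ∈ f′ ∷ F) → ext p ∈ f ∷ map e F
        ext∈ (here _)  = here refl
        ext∈ (there p) = there (∈-map⁺ e p)

        ext-⇔ : ∀ {g h} (p : g ∈ f′ ∷ F) (q : h ∈ f′ ∷ F) → (ext p ≤ᴳ ext q) ⇔ (g ≤ᴳ h)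
        ext-⇔ (here refl) (here refl) = mk⇔ (const (≤ᴳ-refl f′)) (const (≤ᴳ-refl f))
        ext-⇔ (here refl) (there q)   = up q
        ext-⇔ (there p)   (here refl) = down p
        ext-⇔ (there p)   (there q)   = e-⇔ p q

-- Redundant coordinates.

Distinguishes : ∀ {t n} → Fin n → Grid t n → Grid t n → Set
Distinguishes i g h =
  (∀ j → j ≢ i → lookup g j Fin.≤ lookup h j) × ¬ (lookup g i Fin.≤ lookup h i)

Distinguishing : ∀ {t n} → Family t n → Fin n → Set
Distinguishing F i = ∃[ g ] ∃[ h ] g ∈ F × h ∈ F × Distinguishes i g h

-- A distinguished pair determines its coordinate, as the comparison fails there and nowhere else.
-- So choosing a pair for each `i` injects `Fin n` into the pairs of positions in `F`.
all-Distinguishing⇒n≤∣F∣² : ∀ {t n} (F : Family t n) →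
  (∀ i → Distinguishing F i) → n ≤ length F * length F
all-Distinguishing⇒n≤∣F∣² {n = n} F dist = ℕₚ.≮⇒≥ λ small →
  let i , j , i<j , same = Finₚ.pigeonhole small code
  in  collision (Finₚ.<⇒≢ i<j) (dist i) (dist j) same
  where
  pairIndex : ∀ {i} → Distinguishing F i → Fin (length F * length F)
  pairIndex (_ , _ , g∈ , h∈ , _) = combine (index g∈) (index h∈)

  code : Fin n → Fin (length F * length F)
  code i = pairIndex (dist i)

  index-injective : ∀ {g h} (g∈ : g ∈ F) (h∈ : h ∈ F) → index g∈ ≡ index h∈ → g ≡ h
  index-injective g∈ h∈ eq =
    trans (lookup-index g∈) (trans (cong (List.lookup F) eq) (sym (lookup-index h∈)))

  collision : ∀ {i j} → i ≢ j → (p : Distinguishing F i) (q : Distinguishing F j) →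
    pairIndex p ≡ pairIndex q → ⊥
  collision i≢j (g , h , g∈ , h∈ , _ , g≰h) (g′ , h′ , g′∈ , h′∈ , rest , _) same
    with Finₚ.combine-injective (index g∈) (index h∈) (index g′∈) (index h′∈) same
  ... | eq₁ , eq₂ with index-injective g∈ g′∈ eq₁ | index-injective h∈ h′∈ eq₂
  ... | refl | refl = g≰h (rest _ i≢j)

Redundant : ∀ {t n} → Family t n → Fin n → Set
Redundant F i = ∀ g h → g ∈ F → h ∈ F →
  (∀ j → j ≢ i → lookup g j Fin.≤ lookup h j) → lookup g i Fin.≤ lookup h i

¬Distinguishing⇒Redundant : ∀ {t n} {F : Family t n} {i} → ¬ Distinguishing F i → Redundant F i
¬Distinguishing⇒Redundant {i = i} ¬d g h g∈ h∈ rest =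
  decidable-stable (lookup g i Finₚ.≤? lookup h i) λ g≰h → ¬d (g , h , g∈ , h∈ , rest , g≰h)

redundant-coordinate : ExcludedMiddle 0ℓ → ∀ {t n} (F : Family t n) →
  length F * length F < n → ∃ (Redundant F)
redundant-coordinate em F small = em⇒dne em λ none →
  ℕₚ.<⇒≱ small (all-Distinguishing⇒n≤∣F∣² F λ i →
    em⇒dne em λ ¬d → none (i , ¬Distinguishing⇒Redundant ¬d))

-- Repeating a redundant coordinate.

≤ᴳ-split : ∀ {t n} (f g : Grid t n) (i : Fin n) →
  (∀ j → j ≢ i → lookup f j Fin.≤ lookup g j) → lookup f i Fin.≤ lookup g i → f ≤ᴳ g
≤ᴳ-split f g i rest at-i j with j Finₚ.≟ i
... | yes refl = at-i
... | no j≢i   = rest j j≢i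

-- Only extreme values occur, so comparing a point with a block of copies is either vacuous or
-- forces its whole block to be extreme.
threshold : ∀ {s} → Fin (2 + s) → Fin (2 + s)
threshold zero    = zero
threshold (suc _) = fromℕ _

threshold-mono-≤ : ∀ {s} {x y : Fin (2 + s)} → x Fin.≤ y → threshold x Fin.≤ threshold y
threshold-mono-≤ {x = zero}              _ = z≤n
threshold-mono-≤ {x = suc _} {y = suc _} _ = Finₚ.≤-refl

≢0⇒≤threshold : ∀ {s} {x y : Fin (2 + s)} → y ≢ zero → x Fin.≤ threshold y
≢0⇒≤threshold {y = zero}  y≢0 = ⊥-elim (y≢0 refl)
≢0⇒≤threshold {y = suc _} _   = Finₚ.≤fromℕ _

≢0-≤ : ∀ {s} {x y : Fin (suc s)} → x ≢ zero → x Fin.≤ y → y ≢ zero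
≢0-≤ {x = zero}  x≢0 _  _    = x≢0 refl
≢0-≤ {x = suc _} _   () refl

-- ρ : Fin m → Fin n repeats coordinate i and no other one.
module Repeat {s m n : ℕ} (i : Fin n) (ρ : Fin m → Fin n) (σ : Fin n → Fin m)
  (ρσ : ∀ j → ρ (σ j) ≡ j) (σρ : ∀ k → ρ k ≢ i → σ (ρ k) ≡ k) where

  t : ℕ
  t = 2 + s

  repeat : Grid t n → Grid t m
  repeat g = tabulate λ k → lookup (updateAt g i threshold) (ρ k)

  lookup-repeat-≡ : ∀ g {k} → ρ k ≡ i → lookup (repeat g) k ≡ threshold (lookup g i)
  lookup-repeat-≡ g {k} refl =
    trans (Vecₚ.lookup∘tabulate _ k) (Vecₚ.lookup∘updateAt (ρ k) g)

  lookup-repeat-≢ : ∀ g {k} → ρ k ≢ i → lookup (repeat g) k ≡ lookup g (ρ k)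
  lookup-repeat-≢ g {k} ρk≢i =
    trans (Vecₚ.lookup∘tabulate _ k) (Vecₚ.lookup∘updateAt′ (ρ k) i ρk≢i g)

  lookup-repeat-σ : ∀ g {j} → j ≢ i → lookup (repeat g) (σ j) ≡ lookup g j
  lookup-repeat-σ g {j} j≢i =
    trans (lookup-repeat-≢ g (j≢i ∘ trans (sym (ρσ j)))) (cong (lookup g) (ρσ j))

  module _ (f : Grid t m) (g : Grid t n) where

    ≤repeat-⇔ : (f ≤ᴳ repeat g) ⇔
      ((∀ j → j ≢ i → lookup f (σ j) Fin.≤ lookup g j) ×
       (∀ k → ρ k ≡ i → lookup f k Fin.≤ threshold (lookup g i)))
    ≤repeat-⇔ = mk⇔
      (λ le → (λ j j≢i → subst (lookup f (σ j) Fin.≤_) (lookup-repeat-σ g j≢i) (le (σ j)))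
            , (λ k ρk≡i → subst (lookup f k Fin.≤_) (lookup-repeat-≡ g ρk≡i) (le k)))
      (λ (rest , block) k → glue rest block k (ρ k Finₚ.≟ i))
      where
      glue : (∀ j → j ≢ i → lookup f (σ j) Fin.≤ lookup g j) →
             (∀ k → ρ k ≡ i → lookup f k Fin.≤ threshold (lookup g i)) →
             ∀ k → Dec (ρ k ≡ i) → lookup f k Fin.≤ lookup (repeat g) k
      glue rest block k (yes ρk≡i) =
        subst (lookup f k Fin.≤_) (sym (lookup-repeat-≡ g ρk≡i)) (block k ρk≡i)
      glue rest block k (no ρk≢i) =
        subst₂ Fin._≤_ (cong (lookup f) (σρ k ρk≢i)) (sym (lookup-repeat-≢ g ρk≢i)) (rest (ρ k) ρk≢i)

    repeat≤-⇔ : (repeat g ≤ᴳ f) ⇔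
      ((∀ j → j ≢ i → lookup g j Fin.≤ lookup f (σ j)) ×
       (∀ k → ρ k ≡ i → threshold (lookup g i) Fin.≤ lookup f k))
    repeat≤-⇔ = mk⇔
      (λ le → (λ j j≢i → subst (Fin._≤ lookup f (σ j)) (lookup-repeat-σ g j≢i) (le (σ j)))
            , (λ k ρk≡i → subst (Fin._≤ lookup f k) (lookup-repeat-≡ g ρk≡i) (le k)))
      (λ (rest , block) k → glue rest block k (ρ k Finₚ.≟ i))
      where
      glue : (∀ j → j ≢ i → lookup g j Fin.≤ lookup f (σ j)) →
             (∀ k → ρ k ≡ i → threshold (lookup g i) Fin.≤ lookup f k) →
             ∀ k → Dec (ρ k ≡ i) → lookup (repeat g) k Fin.≤ lookup f k
      glue rest block k (yes ρk≡i) =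
        subst (Fin._≤ lookup f k) (sym (lookup-repeat-≡ g ρk≡i)) (block k ρk≡i)
      glue rest block k (no ρk≢i) =
        subst₂ Fin._≤_ (sym (lookup-repeat-≢ g ρk≢i)) (cong (lookup f) (σρ k ρk≢i)) (rest (ρ k) ρk≢i)

  module _ (em : ExcludedMiddle 0ℓ) (F : Family t n) (redundant : Redundant F i) where

    -- `threshold` may merge values, so the inequality at `i` cannot be read off from the images;
    -- redundancy recovers it from the other coordinates.
    repeat-⇔ : ∀ {g h} → g ∈ F → h ∈ F → (repeat g ≤ᴳ repeat h) ⇔ (g ≤ᴳ h)
    repeat-⇔ {g} {h} g∈ h∈ = mk⇔ reflects preserves
      where
      reflects : repeat g ≤ᴳ repeat h → g ≤ᴳ h
      reflects le = ≤ᴳ-split g h i rest (redundant g h g∈ h∈ rest)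
        where
        rest : ∀ j → j ≢ i → lookup g j Fin.≤ lookup h j
        rest j j≢i = subst (Fin._≤ lookup h j) (lookup-repeat-σ g j≢i)
          (proj₁ (to (≤repeat-⇔ (repeat g) h) le) j j≢i)

      preserves : g ≤ᴳ h → repeat g ≤ᴳ repeat h
      preserves le = from (≤repeat-⇔ (repeat g) h)
        ( (λ j j≢i → subst (Fin._≤ lookup h j) (sym (lookup-repeat-σ g j≢i)) (le j))
        , (λ k ρk≡i → subst (Fin._≤ threshold (lookup h i)) (sym (lookup-repeat-≡ g ρk≡i))
            (threshold-mono-≤ (le i))))

    module _ (f : Grid t m) where

      Below Above : Grid t n → Set
      Below g = ∀ j → j ≢ i → lookup g j Fin.≤ lookup f (σ j)
      Above h = ∀ j → j ≢ i → lookup f (σ j) Fin.≤ lookup h j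

      BlockBelow BlockAbove : Fin t → Set
      BlockBelow x = ∀ k → ρ k ≡ i → lookup f k Fin.≤ x
      BlockAbove x = ∀ k → ρ k ≡ i → x Fin.≤ lookup f k

      -- The value c at i has the same effect as the whole block ρ⁻¹(i) of f.
      Simulates : Fin t → Set
      Simulates c =
          (∀ {h} → h ∈ F → Above h → (c Fin.≤ lookup h i) ⇔ BlockBelow (threshold (lookup h i)))
        × (∀ {g} → g ∈ F → Below g → (lookup g i Fin.≤ c) ⇔ BlockAbove (threshold (lookup g i)))

      -- Passing through `f` orders `g` and `h` off `i`; redundancy then supplies coordinate `i`.
      Below≤Above : ∀ {g h} → g ∈ F → h ∈ F → Below g → Above h → lookup g i Fin.≤ lookup h i
      Below≤Above g∈ h∈ below above =
        redundant _ _ g∈ h∈ λ j j≢i → Finₚ.≤-trans (below j j≢i) (above j j≢i)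

      -- The largest value at `i` among the members in `Below` works, with `zero` as default when
      -- there are none.
      separator : ∃[ c ] (∀ {g} → g ∈ F → Below g → lookup g i Fin.≤ c)
                       × (∀ {h} → h ∈ F → Above h → c Fin.≤ lookup h i)
      separator = max zero values
        , (λ g∈ below → All.lookup (xs≤max zero values)
            (∈-map⁺ (λ g → lookup g i) (∈-filter⁺ below? g∈ below)))
        , (λ h∈ above → max≤v⁺ z≤n (Allₚ.map⁺ (All.tabulate λ g∈′ →
            let g∈ , below = ∈-filter⁻ below? g∈′ in Below≤Above g∈ h∈ below above)))
        where
        open Extrema (Finₚ.≤-totalOrder t) using (max; xs≤max; max≤v⁺)

        below? : ∀ g → Dec (Below g)
        below? g = em

        values : List (Fin t)
        values = map (λ g → lookup g i) (filter below? F)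

      -- `BlockBelow` is vacuous for members nonzero at `i`, and `BlockAbove` for those zero at `i`.
      -- If some member in `Below` is nonzero at `i`, so are all in `Above`; hence at most one side
      -- is cut.
      simulate : ∃ Simulates
      simulate with em {∃[ g ] g ∈ F × Below g × lookup g i ≢ zero}
                  | em {BlockAbove (fromℕ _)} | em {BlockBelow zero}
      -- The block cuts neither side, so a value between the two sides is needed.
      ... | yes (g , g∈ , below , g≢0) | yes all-top | _ =
        let c , lower , upper = separator
        in  c , (λ h∈ above → mk⇔ (λ _ → nonzero h∈ above) (λ _ → upper h∈ above))
              , (λ g∈ below → mk⇔ (λ _ k ρk≡i → Finₚ.≤-trans (Finₚ.≤fromℕ _) (all-top k ρk≡i))
                                  (λ _ → lower g∈ below))
        where
        nonzero : ∀ {h} → h ∈ F → Above h → BlockBelow (threshold (lookup h i))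
        nonzero h∈ above k _ = ≢0⇒≤threshold (≢0-≤ g≢0 (Below≤Above g∈ h∈ below above))
      -- The block cuts the nonzero members from `Below`, as does the value `zero`.
      ... | yes (g , g∈ , below , g≢0) | no ¬all-top | _ =
        zero , (λ h∈ above → mk⇔ (λ _ k _ → ≢0⇒≤threshold (≢0-≤ g≢0 (Below≤Above g∈ h∈ below above)))
                                 (λ _ → z≤n))
             , (λ {g′} _ _ → cut (lookup g′ i))
        where
        cut : ∀ x → (x Fin.≤ zero {suc s}) ⇔ BlockAbove (threshold x)
        cut zero    = mk⇔ (λ _ _ _ → z≤n) (λ _ → z≤n)
        cut (suc _) = mk⇔ (λ ()) (⊥-elim ∘ ¬all-top)
      -- All of `Below` is zero at `i` and the block cuts nothing.
      ... | no none | _ | yes all-zero =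
        zero , (λ h∈ above → mk⇔ (λ _ k ρk≡i → Finₚ.≤-trans (all-zero k ρk≡i) z≤n) (λ _ → z≤n))
             , (λ {g} g∈ below → all-below (lookup g i) (λ g≢0 → none (g , g∈ , below , g≢0)))
        where
        all-below : ∀ x → ¬ (x ≢ zero) → (x Fin.≤ zero {suc s}) ⇔ BlockAbove (threshold x)
        all-below zero    _   = mk⇔ (λ _ _ _ → z≤n) (λ _ → z≤n)
        all-below (suc _) ¬≢0 = ⊥-elim (¬≢0 λ ())
      -- The block cuts the zero members from `Above`, as does the value 1, which exists since `t`
      -- is at least 2.
      ... | no none | _ | no ¬all-zero =
        suc zero , (λ {h} _ _ → cut (lookup h i))
                 , (λ {g} g∈ below → all-below (lookup g i) (λ g≢0 → none (g , g∈ , below , g≢0)))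
        where
        cut : ∀ x → (suc (zero {s}) Fin.≤ x) ⇔ BlockBelow (threshold x)
        cut zero    = mk⇔ (λ ()) (⊥-elim ∘ ¬all-zero)
        cut (suc _) = mk⇔ (λ _ k _ → Finₚ.≤fromℕ (lookup f k)) (λ _ → s≤s z≤n)

        all-below : ∀ x → ¬ (x ≢ zero) → (x Fin.≤ suc (zero {s})) ⇔ BlockAbove (threshold x)
        all-below zero    _   = mk⇔ (λ _ _ _ → z≤n) (λ _ → z≤n)
        all-below (suc _) ¬≢0 = ⊥-elim (¬≢0 λ ())

      -- Off `i` the point `f′` copies `f` through `σ`; at `i` it takes the simulating value.
      -- `Simulates` concerns only members comparable with `f` off `i`, which either side of each
      -- equivalence provides.
      proxy : ∃[ f′ ] (∀ {g} → g ∈ F → (f ≤ᴳ repeat g) ⇔ (f′ ≤ᴳ g))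
                    × (∀ {g} → g ∈ F → (repeat g ≤ᴳ f) ⇔ (g ≤ᴳ f′))
      proxy with simulate
      ... | c , above-⇔ , below-⇔ = f′ , up , down
        where
        f′ : Grid t n
        f′ = tabulate (lookup f ∘ σ) [ i ]≔ c

        f′-i : lookup f′ i ≡ c
        f′-i = Vecₚ.lookup∘updateAt i (tabulate (lookup f ∘ σ))

        f′-rest : ∀ j → j ≢ i → lookup f′ j ≡ lookup f (σ j)
        f′-rest j j≢i = trans (Vecₚ.lookup∘updateAt′ j i j≢i (tabulate (lookup f ∘ σ)))
          (Vecₚ.lookup∘tabulate _ j)

        up : ∀ {g} → g ∈ F → (f ≤ᴳ repeat g) ⇔ (f′ ≤ᴳ g)
        up {g} g∈ = mk⇔
          (λ le → let rest , block = to (≤repeat-⇔ f g) le in ≤ᴳ-split f′ g i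
            (λ j j≢i → subst (Fin._≤ lookup g j) (sym (f′-rest j j≢i)) (rest j j≢i))
            (subst (Fin._≤ lookup g i) (sym f′-i) (from (above-⇔ g∈ rest) block)))
          (λ le → let rest = λ j j≢i → subst (Fin._≤ lookup g j) (f′-rest j j≢i) (le j) in
            from (≤repeat-⇔ f g)
              (rest , to (above-⇔ g∈ rest) (subst (Fin._≤ lookup g i) f′-i (le i))))

        down : ∀ {g} → g ∈ F → (repeat g ≤ᴳ f) ⇔ (g ≤ᴳ f′)
        down {g} g∈ = mk⇔
          (λ le → let rest , block = to (repeat≤-⇔ f g) le in ≤ᴳ-split g f′ i
            (λ j j≢i → subst (lookup g j Fin.≤_) (sym (f′-rest j j≢i)) (rest j j≢i))
            (subst (lookup g i Fin.≤_) (sym f′-i) (from (below-⇔ g∈ rest) block)))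
          (λ le → let rest = λ j j≢i → subst (lookup g j Fin.≤_) (f′-rest j j≢i) (le j) in
            from (repeat≤-⇔ f g)
              (rest , to (below-⇔ g∈ rest) (subst (lookup g i Fin.≤_) f′-i (le i))))

-- Lifting small saturated families to larger dimensions.

HasSaturated : FinitePoset → ℕ → ℕ → ℕ → Set
HasSaturated P t n l = ∃[ F ] Unique F × InducedSaturated P {t} {n} F × length F ≡ l

module _ (em : ExcludedMiddle 0ℓ) (P : FinitePoset) where

  HasSaturated-lift : ∀ {s n m l} → l * l < n → n ≤ m →
    HasSaturated P (2 + s) n l → HasSaturated P (2 + s) m l
  HasSaturated-lift {s} {n} small n≤m (F , unique , sat , refl)
    with redundant-coordinate em F small | ℕₚ.m≤n⇒∃[o]m+o≡n n≤m
  ... | i , redundant | o , refl =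
      map repeat F
    , map-Unique P F repeat (repeat-⇔ em F redundant) unique
    , map-InducedSaturated P F repeat (repeat-⇔ em F redundant) (proxy em F redundant) sat
    , length-map repeat F
    where
    -- The first `n` coordinates stay in place, and all `o` new ones are copies of `i`.
    ρ : Fin (n + o) → Fin n
    ρ k = [ id , const i ]′ (splitAt n k)

    ρσ : ∀ j → ρ (j ↑ˡ o) ≡ j
    ρσ j = cong [ id , const i ]′ (Finₚ.splitAt-↑ˡ n j o)

    σρ : ∀ k → ρ k ≢ i → ρ k ↑ˡ o ≡ k
    σρ k ρk≢i with splitAt n k in eq
    ... | inj₁ j = Finₚ.splitAt⁻¹-↑ˡ eq
    ... | inj₂ _ = ⊥-elim (ρk≢i refl)

    open Repeat {s} i ρ (_↑ˡ o) ρσ σρ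

  -- Existence and minimality of saturated families.

  module _ (x : FinitePoset.Carrier P) where

    -- Greedy construction: a point of `L` not yet present is added unless it would complete a copy.
    -- The element `x` of `P` makes the empty family free.
    saturate : ∀ {t n} (L : List (Grid t n)) →
      ∃[ F ] Unique F × InducedFree P F × (∀ {f} → f ∈ L → f ∉ F → InducedCopy P (f ∷ F))
    saturate [] = [] , [] , (λ c → case InducedCopy.in-family c x of λ ()) , λ ()
    saturate (f ∷ L) with saturate L
    ... | F , unique , free , sat with em {f ∈ F} | em {InducedCopy P (f ∷ F)}
    ... | yes f∈ | _ = F , unique , free , λ
      { (here refl) f∉ → ⊥-elim (f∉ f∈)
      ; (there g∈)  → sat g∈ }
    ... | no _ | yes copy = F , unique , free , λ
      { (here refl) _ → copy
      ; (there g∈)  → sat g∈ }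
    ... | no f∉ | no free′ = f ∷ F , Allₚ.¬Any⇒All¬ F f∉ ∷ unique , free′ , λ
      { (here refl) f∉′ → ⊥-elim (f∉′ (here refl))
      -- A copy found earlier survives because the family only grows.
      ; (there g∈)  g∉ → InducedCopy-⊆ P (∷⁺ʳ _ (xs⊆x∷xs F f)) (sat g∈ (g∉ ∘ there)) }

    saturated-exists : ∀ t n → ∃ (HasSaturated P t n)
    saturated-exists t n =
      let F , unique , free , sat = saturate (grid t n)
      in  length F , F , unique , (free , λ f → sat (∈-grid f)) , refl

    -- Descent on the size: a realised size is either minimal or has a smaller realised one.
    IsSat-exists : ∀ t n → ∃ (IsSat P t n)
    IsSat-exists t n = let l , has = saturated-exists t n in <-rec _ least l has
      where
      least : ∀ l → (∀ {k} → k < l → HasSaturated P t n k → ∃ (IsSat P t n)) →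
              HasSaturated P t n l → ∃ (IsSat P t n)
      least l rec has with em {∃[ k ] k < l × HasSaturated P t n k}
      ... | yes (k , k<l , has′) = rec k<l has′
      ... | no minimal = l , has , λ F unique sat →
        ℕₚ.≮⇒≥ λ F<l → minimal (length F , F<l , F , unique , sat , refl)

    sat⋆-HasSaturated : ∀ t n → HasSaturated P t n (sat⋆ em P t n)
    sat⋆-HasSaturated t n with em {∃[ m ] IsSat P t n m}
    ... | yes (_ , has , _) = has
    ... | no ¬isSat         = ⊥-elim (¬isSat (IsSat-exists t n))

  sat⋆-≤ : ∀ {t n l} → HasSaturated P t n l → sat⋆ em P t n ≤ l
  sat⋆-≤ {t} {n} (F , unique , sat , refl) with em {∃[ m ] IsSat P t n m}
  ... | yes (_ , _ , minimal) = minimal F unique sat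
  ... | no _                  = z≤n

  -- The empty map is a copy in every family, so no family is free and the default 0 applies.
  sat⋆-empty : ¬ FinitePoset.Carrier P → ∀ t n → sat⋆ em P t n ≡ 0
  sat⋆-empty empty t n with em {∃[ m ] IsSat P t n m}
  ... | yes (_ , (F , _ , (free , _) , _) , _) =
    ⊥-elim (free (inducedCopy P (⊥-elim ∘ empty) (⊥-elim ∘ empty) (⊥-elim ∘ empty)))
  ... | no _ = refl

mainTheorem1 : (em : ExcludedMiddle 0ℓ) (P : FinitePoset) (t : ℕ) → 2 ≤ t →
    Ω[√n] (λ n → sat⋆ em P t n) ⊎ O[1] (λ n → sat⋆ em P t n)
mainTheorem1 em P t@(suc (suc _)) (s≤s (s≤s _))
  with em {FinitePoset.Carrier P} | em {∃[ n ] ∃[ l ] l * l < n × HasSaturated P t n l}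
... | no empty | _ = inj₂ (0 , 0 , λ n _ → ℕₚ.≤-reflexive (sat⋆-empty em P empty t n))
-- One small family bounds all later values: `C = l` from `N = n` on.
... | yes _ | yes (n , l , small , has) =
  inj₂ (l , n , λ m n≤m → sat⋆-≤ em P (HasSaturated-lift em P small n≤m has))
-- The square of `sat⋆` is at least `n` for every `n`, so `p = q = 1` and `N = 0` serve;
-- `+-monoˡ-≤ 0` matches the `+ 0` left by multiplying by 1.
... | yes x | no large = inj₁ (1 , 1 , 0 , z<s , z<s , λ n _ →
  ℕₚ.+-monoˡ-≤ 0 (ℕₚ.≮⇒≥ λ small → large (n , _ , small , sat⋆-HasSaturated em P x t n)))
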